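{- Let $\mathcal{C}$ be a frieze with coefficients on an $n$-gon over the positive integers. Then $\mathcal{C}$ appears as a subpolygon of some Conway-Coxeter frieze if and only if the following two conditions are satisfied: (1) for any triangle in $\mathcal{C}$, with labels $a,b,c$ of its three sides, we have $\gcd(a,b)=\gcd(b,c)=\gcd(a,c)$; (2) for every prime number $p<n$ and every $(p+1)$-subpolygon $\mathcal{D}$ of $\mathcal{C}$, the labels of the edges and diagonals of $\mathcal{D}$ are either all not divisible by $p$, or they do not all have the same $p$-valuation.
   Context: Label the vertices of a regular $n$-gon by $0,1,\dots,n-1$ in cyclic (counterclockwise) order. A frieze with coefficients on the $n$-gon over a set $R$ is a map $\mathcal{C}$ assigning to each edge or diagonal $\{i,j\}$ ($i\neq j$) a value $c_{i,j}=c_{j,i}\in R$ such that all Ptolemy relations hold: $c_{i,k}c_{j,\ell}=c_{i,\ell}c_{j,k}+c_{i,j}c_{k,\ell}$ for all vertices $i<j<k<\ell$. (Equivalently, a tame frieze pattern with coefficients of height $n-3$; over the positive integers all such are tame.) A subpolygon of $\mathcal{C}$ on a subset $S$ of $k$ vertices is the restriction of $\mathcal{C}$ to the edges and diagonals of the $k$-gon with vertex set $S$ (in inherited cyclic order); it is again a frieze with coefficients. A triangle in $\mathcal{C}$ is a 3-subpolygon. A Conway-Coxeter frieze is a frieze with coefficients over the positive integers on some polygon in which every boundary edge $\{i,i+1\}$ (indices mod the number of vertices) has label $1$. $\mathcal{C}$ appears as a subpolygon of a Conway-Coxeter frieze $\mathcal{E}$ if $\mathcal{C}$ coincides (after relabelling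 vertices preserving cyclic order) with a subpolygon of $\mathcal{E}$. The $p$-valuation $\nu_p(u)$ of a positive integer $u$ is the exponent of $p$ in $u$. -}

module Defs where

open import Data.Nat using (ℕ; zero; suc; _+_; _*_; _^_; _≤_; _<_)
open import Data.Nat.Divisibility using (_∣_)
open import Data.Nat.GCD using (gcd)
open import Data.Nat.Primality using (Prime)
open import Data.Fin as F using (Fin; toℕ)
open import Data.Product using (Σ; _×_; ∃-syntax)
open import Data.Sum using (_⊎_)
open import Relation.Nullary using (¬_)
open import Relation.Binary.PropositionalEquality using (_≡_; _≢_)

-- Labels of edges/diagonals of an n-gon with vertices 0..n-1 (Fin n).
-- Only the values c i j with i ≢ j are meaningful.
Labels : ℕ → Set
Labels n = Fin n → Fin n → ℕ

record IsPosFrieze (n : ℕ) (c : Labels n) : Set where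
  field
    symm     : ∀ i j → c i j ≡ c j i
    positive : ∀ i j → i ≢ j → 0 < c i j
    ptolemy  : ∀ i j k l → i F.< j → j F.< k → k F.< l →
               c i k * c j l ≡ c i l * c j k + c i j * c k l

record IsConwayCoxeter (m : ℕ) (e : Labels m) : Set where
  field
    atLeast3   : 3 ≤ m
    frieze     : IsPosFrieze m e
    boundary   : ∀ (i j : Fin m) → suc (toℕ i) ≡ toℕ j → e i j ≡ 1
    boundaryWr : ∀ (i j : Fin m) → toℕ i ≡ 0 → suc (toℕ j) ≡ m → e i j ≡ 1

CyclicOrderPreserving : ∀ {n m} → (Fin n → Fin m) → Set
CyclicOrderPreserving g = ∀ i j k → i F.< j → j F.< k →
  (g i F.< g j × g j F.< g k) ⊎ (g j F.< g k × g k F.< g i) ⊎ (g k F.< g i × g i F.< g j)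

AppearsInCC : ∀ {n} → Labels n → Set
AppearsInCC {n} c = ∃[ m ] ∃[ e ] ∃[ g ]
  (IsConwayCoxeter m e × CyclicOrderPreserving {n} {m} g ×
   (∀ i j → i ≢ j → c i j ≡ e (g i) (g j)))

-- Strictly increasing maps Fin k → Fin n: choice of a k-subset of vertices
-- in inherited (cyclic) order; the subpolygon is c (f i) (f j).
StrictlyIncreasing : ∀ {k n} → (Fin k → Fin n) → Set
StrictlyIncreasing f = ∀ i j → i F.< j → f i F.< f j

TriangleCondition : ∀ {n} → Labels n → Set
TriangleCondition {n} c = ∀ (f : Fin 3 → Fin n) → StrictlyIncreasing f →
  let a = c (f F.zero) (f (F.suc F.zero))
      b = c (f (F.suc F.zero)) (f (F.suc (F.suc F.zero)))
      d = c (f F.zero) (f (F.suc (F.suc F.zero)))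
  in (gcd a b ≡ gcd b d) × (gcd b d ≡ gcd a d)

HasValuation : ℕ → ℕ → ℕ → Set
HasValuation p u v = (p ^ v ∣ u) × ¬ (p ^ suc v ∣ u)

PrimeCondition : ∀ {n} → Labels n → Set
PrimeCondition {n} c = ∀ p → Prime p → p < n →
  ∀ (f : Fin (suc p) → Fin n) → StrictlyIncreasing f →
  (∀ i j → i F.< j → ¬ (p ∣ c (f i) (f j)))
  ⊎ ¬ (∃[ v ] (∀ i j → i F.< j → HasValuation p (c (f i) (f j)) v))

{-# OPTIONS --safe #-}
-- A frieze appears in a Conway–Coxeter frieze iff its labels are c i j = |det (v i) (v j)| for
-- primitive vectors v i ∈ ℤ² in angular order within a half-turn: refining each sector between
-- consecutive rays into unimodular sectors produces the Conway–Coxeter frieze.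
--
-- Necessity. Primitivity of the middle vertex of a triangle gives (1).  If p + 1 of the vectors
-- had pairwise determinants of one valuation e ≥ 1, they would be proportional modulo p, and dividing
-- by pᵉ would give p + 1 distinct slopes in 𝔽ₚ.
--
-- Sufficiency. Let g be the gcd of all labels. By (1), the lattice spanned by the vertex vectors
-- realises c / g by primitive vectors (ξ i , η i). Then (ξ i + s η i , g η i) realises c, and it
-- is primitive once ξ i + s η i is coprime to g. By (2), for every prime p ∣ g the slopes do not
-- cover the projective line over 𝔽ₚ, so a suitable s exists modulo p, and these residues are
-- glued by the Chinese remainder theorem.
module Submission where

open import Defs
open import Data.Nat using (ℕ; _≤_)
open import Data.Product using (_×_)
open import Function.Bundles using (_⇔_)

open import Data.Empty using (⊥)
open import Data.Fin as F using (Fin; toℕ)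
import Data.Fin.Properties as F
open import Data.Integer as ℤ using (ℤ; +_; -[1+_]; _+_; _*_; _-_; -_; ∣_∣; 0ℤ; 1ℤ)
open import Data.Integer.DivMod using (_%ℕ_; _/ℕ_; n%ℕd<d; a≡a%ℕn+[a/ℕn]*n)
open import Data.Integer.Divisibility.Signed
import Data.Integer.Properties as ℤ
open import Data.Integer.Tactic.RingSolver using (solve-∀)
open import Data.List using (List; []; _∷_; lookup; length)
import Data.List.Relation.Unary.All as All
open import Data.List.Relation.Unary.All using (All; []; _∷_)
open import Data.Nat as ℕ using (zero; suc; s≤s; z≤n)
import Data.Nat.Divisibility as ℕ
open import Data.Nat.GCD using (gcd; gcd[m,n]∣m; gcd[m,n]∣n; gcd-GCD; gcd-comm; gcd-greatest; module Bézout)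
open import Data.Nat.Induction using (<-wellFounded)
open import Data.Nat.ListAction using (product)
open import Data.Nat.ListAction.Properties using (∈⇒∣product)
open import Data.Nat.Primality using (Prime; euclidsLemma; prime⇒nonTrivial; prime⇒nonZero; prime⇒irreducible)
open import Data.Nat.Primality using (prime[2]; ¬prime[0])
open import Data.Nat.Primality.Factorisation using (factorise; PrimeFactorisation; factorisationHasAllPrimeFactors)
import Data.Nat.Properties as ℕ
open import Data.Product using (∃; ∃₂; _,_; proj₁; proj₂; ∃-syntax; map₂)
open import Data.Sum as Sum using (_⊎_; inj₁; inj₂)
open import Function using (_∘_; id; case_of_)
open import Function.Bundles using (mk⇔)
open import Induction.WellFounded using (Acc; acc)
open import Relation.Binary using (tri<; tri≈; tri>)
open import Relation.Binary.PropositionalEquality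
open import Relation.Nullary using (¬_; yes; no; contradiction)
open import Relation.Nullary.Decidable using (_→-dec_; ¬?; decidable-stable)

-- Determinants and primitive vectors

V : Set
V = ℤ × ℤ

det : V → V → ℤ
det (a , b) (c , d) = a * d - b * c

det-self : ∀ u → det u u ≡ 0ℤ
det-self (a , b) = lemma a b
  where
  lemma : ∀ a b → a * b - b * a ≡ 0ℤ
  lemma = solve-∀

det-axis : ∀ v → det (1ℤ , 0ℤ) v ≡ proj₂ v
det-axis (x , y) = lemma x y
  where
  lemma : ∀ x y → 1ℤ * y - 0ℤ * x ≡ y
  lemma = solve-∀

det-antisym : ∀ u v → det u v ≡ - det v u
det-antisym (a , b) (c , d) = lemma a b c d
  where
  lemma : ∀ a b c d → a * d - b * c ≡ - (c * b - d * a)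
  lemma = solve-∀

-- Ptolemy's relation with signs, hence free of ordering hypotheses. When one of the six
-- determinants is 1, it also serves as a change of basis.
det-plücker : ∀ u v w z → det u w * det v z ≡ det u z * det v w + det u v * det w z
det-plücker (a , b) (c , d) (e , f) (g , h) = lemma a b c d e f g h
  where
  lemma : ∀ a b c d e f g h →
          (a * f - b * e) * (c * h - d * g) ≡
          (a * h - b * g) * (c * f - d * e) + (a * d - b * c) * (e * h - f * g)
  lemma = solve-∀

-- Bézout form of coprime coordinates: the witness `t` completes `u` to a basis of ℤ² of determinant
-- 1.
Primitive : V → Set
Primitive u = ∃[ t ] det u t ≡ 1ℤ

bézout : ∀ a b → ∃₂ λ s t → s * a + t * b ≡ + gcd ∣ a ∣ ∣ b ∣
bézout a b = fromℕ (Bézout.identity (gcd-GCD ∣ a ∣ ∣ b ∣))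
  where
  g = gcd ∣ a ∣ ∣ b ∣
  sign∣ : ∀ i → ∃[ e ] + ∣ i ∣ ≡ e * i
  sign∣ (+ n)    = 1ℤ , sym (ℤ.*-identityˡ (+ n))
  sign∣ -[1+ n ] = ℤ.-1ℤ , sym (ℤ.-1*i≡-i -[1+ n ])
  cast : ∀ x y m n → g ℕ.+ y ℕ.* n ≡ x ℕ.* m → + g ≡ + x * + m - + y * + n
  cast x y m n eq = trans (lemma (+ g) (+ y * + n)) (cong (_- + y * + n)
    (trans (cong (_+_ (+ g)) (sym (ℤ.pos-* y n))) (trans (cong +_ eq) (ℤ.pos-* x m))))
    where
    lemma : ∀ p q → p ≡ p + q - q
    lemma = solve-∀
  fromℕ : Bézout.Identity g ∣ a ∣ ∣ b ∣ → ∃₂ λ s t → s * a + t * b ≡ + g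
  fromℕ (Bézout.+- x y eq) with sign∣ a | sign∣ b
  ... | e , p | f , q = + x * e , - (+ y * f) , sym (trans (cast x y _ _ eq)
        (trans (cong₂ (λ h k → + x * h - + y * k) p q) (lemma (+ x) (+ y) e f a b)))
    where
    lemma : ∀ x y e f a b → x * (e * a) - y * (f * b) ≡ x * e * a + - (y * f) * b
    lemma = solve-∀
  fromℕ (Bézout.-+ x y eq) with sign∣ a | sign∣ b
  ... | e , p | f , q = - (+ x * e) , + y * f , sym (trans (cast y x _ _ eq)
        (trans (cong₂ (λ h k → + y * k - + x * h) p q) (lemma (+ x) (+ y) e f a b)))
    where
    lemma : ∀ x y e f a b → y * (f * b) - x * (e * a) ≡ - (x * e) * a + y * f * b
    lemma = solve-∀

euclid : ∀ {p} → Prime p → ∀ a b → + p ∣ a * b → (+ p ∣ a) ⊎ (+ p ∣ b)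
euclid {p} pr a b p∣ab = Sum.map ∣ᵤ⇒∣ ∣ᵤ⇒∣
  (euclidsLemma ∣ a ∣ ∣ b ∣ pr (subst (p ℕ.∣_) (ℤ.abs-* a b) (∣⇒∣ᵤ p∣ab)))

prime∤1 : ∀ {p} → Prime p → ¬ (+ p ∣ 1ℤ)
prime∤1 {p} pr p∣1 with ℕ.∣1⇒≡1 (∣⇒∣ᵤ p∣1)
... | refl with () ← prime⇒nonTrivial pr

noPrimeDivisor⇒1 : ∀ n → .{{ℕ.NonZero n}} → (∀ p → Prime p → ¬ (p ℕ.∣ n)) → n ≡ 1
noPrimeDivisor⇒1 n none with factorise n
... | record { factors = [] ; isFactorisation = eq } = eq
... | record { factors = p ∷ ps ; isFactorisation = eq ; factorsPrime = pr ∷ _ } =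
  contradiction (subst (p ℕ.∣_) (sym eq) (ℕ.m∣m*n (product ps))) (none p pr)

noCommonPrime⇒primitive : ∀ x y → (∀ p → Prime p → + p ∣ x → ¬ (+ p ∣ y)) → Primitive (x , y)
noCommonPrime⇒primitive x y none with gcd ∣ x ∣ ∣ y ∣ in eq | bézout x y
-- A gcd of 0 means that both coordinates vanish, so the prime 2 is already a common divisor.
... | zero  | _ = contradiction (∣ᵤ⇒∣ (2∣ (gcd[m,n]∣n ∣ x ∣ ∣ y ∣)))
                    (none 2 prime[2] (∣ᵤ⇒∣ (2∣ (gcd[m,n]∣m ∣ x ∣ ∣ y ∣))))
  where
  2∣ : ∀ {m} → gcd ∣ x ∣ ∣ y ∣ ℕ.∣ m → 2 ℕ.∣ m
  2∣ d = ℕ.∣-trans (subst (2 ℕ.∣_) (sym eq) (2 ℕ.∣0)) d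
... | suc g | s , t , st = (- t , s) , trans (lemma x y s t) (trans st (cong +_
    (noPrimeDivisor⇒1 (suc g) λ p pr p∣ → none p pr
      (∣ᵤ⇒∣ (ℕ.∣-trans (subst (p ℕ.∣_) (sym eq) p∣) (gcd[m,n]∣m ∣ x ∣ ∣ y ∣)))
      (∣ᵤ⇒∣ (ℕ.∣-trans (subst (p ℕ.∣_) (sym eq) p∣) (gcd[m,n]∣n ∣ x ∣ ∣ y ∣))))))
  where
  lemma : ∀ x y s t → x * s - y * - t ≡ s * x + t * y
  lemma = solve-∀

-- Friezes as determinants

module Signed {n} (c : Labels (suc (suc n))) (fr : IsPosFrieze (suc (suc n)) c) where
  open IsPosFrieze fr

  -- The sign given by the vertex order makes the labels alternating, as determinants are.
  D : Fin (suc (suc n)) → Fin (suc (suc n)) → ℤ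
  D i j with F.<-cmp i j
  ... | tri< _ _ _ = + c i j
  ... | tri≈ _ _ _ = 0ℤ
  ... | tri> _ _ _ = - (+ c i j)

  D-< : ∀ {i j} → i F.< j → D i j ≡ + c i j
  D-< {i} {j} i<j with F.<-cmp i j
  ... | tri< _ _ _ = refl
  ... | tri≈ i≮j _ _ = contradiction i<j i≮j
  ... | tri> i≮j _ _ = contradiction i<j i≮j

  D-self : ∀ i → D i i ≡ 0ℤ
  D-self i with F.<-cmp i i
  ... | tri< _ i≢i _ = contradiction refl i≢i
  ... | tri≈ _ _ _   = refl
  ... | tri> _ i≢i _ = contradiction refl i≢i

  D-> : ∀ {i j} → j F.< i → D i j ≡ - (+ c i j)
  D-> {i} {j} j<i with F.<-cmp i j
  ... | tri< _ _ j≮i = contradiction j<i j≮i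
  ... | tri≈ _ _ j≮i = contradiction j<i j≮i
  ... | tri> _ _ _ = refl

  D-antisym : ∀ i j → D i j ≡ - D j i
  D-antisym i j with F.<-cmp i j
  ... | tri< i<j _ _  = trans (cong +_ (symm i j)) (trans (sym (ℤ.neg-involutive _)) (cong -_ (sym (D-> i<j))))
  ... | tri≈ _ refl _ = cong -_ (sym (D-self i))
  ... | tri> _ _ j<i  = cong -_ (trans (cong +_ (symm i j)) (sym (D-< j<i)))

  ∣D∣ : ∀ i j → i ≢ j → ∣ D i j ∣ ≡ c i j
  ∣D∣ i j i≢j with F.<-cmp i j
  ... | tri< _ _ _ = refl
  ... | tri≈ _ i≡j _ = contradiction i≡j i≢j
  ... | tri> _ _ _ = ℤ.∣-i∣≡∣i∣ (+ c i j)

  D-pos : ∀ {i j} → i F.< j → 0ℤ ℤ.< D i j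
  D-pos {i} {j} i<j = subst (0ℤ ℤ.<_) (sym (D-< i<j)) (ℤ.+<+ (positive i j λ i≡j → F.<-irrefl i≡j i<j))

  o₀ o₁ : Fin (suc (suc n))
  o₀ = F.zero
  o₁ = F.suc F.zero

  -- Coordinates of a vertex relative to the first two vertices. Their determinants are the signed
  -- labels up to the constant factor `D o₀ o₁`.
  vec : Fin (suc (suc n)) → V
  vec i = D o₀ i , D o₁ i

  -- For `i` beyond the first two vertices this is the Ptolemy relation for `o₀`, `o₁`, `i`, `j`.
  -- For the first two, a diagonal entry of `D` vanishes and only one product is left.
  det-vec-< : ∀ {i j} → i F.< j → det (vec i) (vec j) ≡ D o₀ o₁ * D i j
  det-vec-< {F.zero} {j} 0<j = trans (cong (λ z → z * D o₁ j - D o₁ o₀ * D o₀ j) (D-self o₀))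
    (trans (cong (λ z → 0ℤ * D o₁ j - z * D o₀ j) (D-antisym o₁ o₀)) (lemma (D o₁ j) (D o₀ o₁) (D o₀ j)))
    where
    lemma : ∀ x y z → 0ℤ * x - - y * z ≡ y * z
    lemma = solve-∀
  det-vec-< {F.suc F.zero} {j} 1<j = trans (cong (λ z → D o₀ o₁ * D o₁ j - z * D o₀ j) (D-self o₁))
    (lemma (D o₁ j) (D o₀ o₁) (D o₀ j))
    where
    lemma : ∀ x y z → y * x - 0ℤ * z ≡ y * x
    lemma = solve-∀
  det-vec-< {i@(F.suc (F.suc i'))} {j} i<j =
    trans (cong₂ _-_ (cong₂ _*_ (D-< 0<i) (D-< 1<j)) (cong₂ _*_ (D-< 1<i) (D-< 0<j)))
    (trans (trans (cong (_- + c o₁ i * + c o₀ j) ptol) (lemma (+ c o₁ i) (+ c o₀ j) (+ c o₀ o₁ * + c i j)))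
           (sym (cong₂ _*_ (D-< 0<1) (D-< i<j))))
    where
    0<1 : o₀ F.< o₁
    0<1 = s≤s z≤n
    1<i : o₁ F.< i
    1<i = s≤s (s≤s z≤n)
    0<i : o₀ F.< i
    0<i = s≤s z≤n
    1<j : o₁ F.< j
    1<j = F.<-trans {i = o₁} {i} {j} 1<i i<j
    0<j : o₀ F.< j
    0<j = F.<-trans {i = o₀} {i} {j} 0<i i<j
    ptol : + c o₀ i * + c o₁ j ≡ + c o₀ j * + c o₁ i + + c o₀ o₁ * + c i j
    ptol = trans (sym (ℤ.pos-* (c o₀ i) (c o₁ j)))
      (trans (cong +_ (ptolemy o₀ o₁ i j 0<1 1<i i<j))
      (cong₂ _+_ (ℤ.pos-* (c o₀ j) (c o₁ i)) (ℤ.pos-* (c o₀ o₁) (c i j))))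
    lemma : ∀ x y z → y * x + z - x * y ≡ z
    lemma = solve-∀

  det-vec : ∀ i j → det (vec i) (vec j) ≡ D o₀ o₁ * D i j
  det-vec i j with F.<-cmp i j
  ... | tri< i<j _ _ = trans (det-vec-< i<j) (cong (D o₀ o₁ *_) (D-< i<j))
  ... | tri≈ _ refl _ = trans (det-self (vec i)) (sym (ℤ.*-zeroʳ (D o₀ o₁)))
  ... | tri> _ _ j<i = trans (det-antisym (vec i) (vec j)) (trans (cong -_ (det-vec-< j<i))
          (trans (ℤ.neg-distribʳ-* (D o₀ o₁) (D j i)) (cong (D o₀ o₁ *_) (trans (sym (D-antisym i j)) (D-> j<i)))))

  -- Multiplied by (D o₀ o₁)², this is the identity for the vectors vec i; no case distinction
  -- on the relative order of i, j, k, l is needed.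
  D-plücker : ∀ i j k l → D i k * D j l ≡ D i l * D j k + D i j * D k l
  D-plücker i j k l = ℤ.*-cancelˡ-≡ δ _ _ {{δ≢0}} (ℤ.*-cancelˡ-≡ δ _ _ {{δ≢0}} (begin
    δ * (δ * (D i k * D j l))             ≡⟨ lemma δ (D i k) (D j l) ⟩
    (δ * D i k) * (δ * D j l)             ≡⟨ cong₂ _*_ (det-vec i k) (det-vec j l) ⟨
    det (vec i) (vec k) * det (vec j) (vec l) ≡⟨ det-plücker (vec i) (vec j) (vec k) (vec l) ⟩
    det (vec i) (vec l) * det (vec j) (vec k) + det (vec i) (vec j) * det (vec k) (vec l)
      ≡⟨ cong₂ _+_ (cong₂ _*_ (det-vec i l) (det-vec j k)) (cong₂ _*_ (det-vec i j) (det-vec k l)) ⟩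
    δ * D i l * (δ * D j k) + δ * D i j * (δ * D k l) ≡⟨ lemma₂ δ (D i l) (D j k) (D i j) (D k l) ⟩
    δ * (δ * (D i l * D j k + D i j * D k l)) ∎))
    where
    open ≡-Reasoning
    δ = D o₀ o₁
    δ≢0 : ℤ.NonZero δ
    δ≢0 = ℤ.>-nonZero (D-pos {o₀} {o₁} (s≤s z≤n))
    lemma : ∀ d x y → d * (d * (x * y)) ≡ d * x * (d * y)
    lemma = solve-∀
    lemma₂ : ∀ d x y z w → d * x * (d * y) + d * z * (d * w) ≡ d * (d * (x * y + z * w))
    lemma₂ = solve-∀

-- Necessity: the triangle condition for primitive vectors

∣-both : ∀ {q x y z} a b → x ≡ a * y + z * b → q ∣ y → q ∣ z → q ∣ x
∣-both a b eq q∣y q∣z = subst (_ ∣_) (sym eq) (∣m∣n⇒∣m+n (∣n⇒∣m*n a q∣y) (∣m⇒∣m*n b q∣z))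

det-∣-trans : ∀ {q} u v w → Primitive v → q ∣ det u v → q ∣ det v w → q ∣ det u w
det-∣-trans u v w (t , det≡1) q∣uv q∣vw = ∣-both (det u t) (det w t)
  (trans (sym (ℤ.*-identityʳ (det u w))) (trans (cong (det u w *_) (sym det≡1)) (det-plücker u v w t)))
  q∣vw q∣uv

det-∣-sym : ∀ {q} u v → q ∣ det u v → q ∣ det v u
det-∣-sym u v q∣ = subst (_ ∣_) (sym (det-antisym v u)) (∣m⇒∣-m q∣)

-- Absolute values keep angular order out of the notion, because a map preserving cyclic order may
-- rotate the vertices.
Realises : ∀ {n} → Labels n → (Fin n → V) → Set
Realises c v = (∀ i j → i ≢ j → ∣ det (v i) (v j) ∣ ≡ c i j) × (∀ i → Primitive (v i))

gcd-cong : ∀ x y z → (∀ {q} → q ℕ.∣ x → q ℕ.∣ y → q ℕ.∣ z) → (∀ {q} → q ℕ.∣ y → q ℕ.∣ z → q ℕ.∣ x) →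
           gcd x y ≡ gcd y z
gcd-cong x y z xy⇒z yz⇒x = ℕ.∣-antisym
  (gcd-greatest (gcd[m,n]∣n x y) (xy⇒z (gcd[m,n]∣m x y) (gcd[m,n]∣n x y)))
  (gcd-greatest (yz⇒x (gcd[m,n]∣m y z) (gcd[m,n]∣n y z)) (gcd[m,n]∣m y z))

realisable⇒triangle : ∀ {n} {c : Labels n} {v} → Realises c v → TriangleCondition c
realisable⇒triangle {c = c} {v} (c≡det , prim) f f↑ =
  gcd-cong _ _ _ (λ q∣ab q∣bd → down a<d (det-∣-trans a b d (prim _) (up a<b q∣ab) (up b<d q∣bd)))
                 (λ q∣bd q∣ad → ad∧bd q∣ad q∣bd) ,
  trans (gcd-cong _ _ _ (λ q∣bd q∣ad → ad∧bd q∣ad q∣bd) ab∧ad)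
        (gcd-comm _ (c (f F.zero) (f (F.suc F.zero))))
  where
  a = v (f F.zero)
  b = v (f (F.suc F.zero))
  d = v (f (F.suc (F.suc F.zero)))
  a<b : f F.zero ≢ f (F.suc F.zero)
  a<b eq = F.<-irrefl eq (f↑ _ _ (s≤s z≤n))
  b<d : f (F.suc F.zero) ≢ f (F.suc (F.suc F.zero))
  b<d eq = F.<-irrefl eq (f↑ _ _ (s≤s (s≤s z≤n)))
  a<d : f F.zero ≢ f (F.suc (F.suc F.zero))
  a<d eq = F.<-irrefl eq (f↑ _ _ (s≤s z≤n))
  up : ∀ {q i j} → i ≢ j → q ℕ.∣ c i j → + q ∣ det (v i) (v j)
  up {q} i≢j q∣ = ∣ᵤ⇒∣ (subst (q ℕ.∣_) (sym (c≡det _ _ i≢j)) q∣)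
  down : ∀ {q i j} → i ≢ j → + q ∣ det (v i) (v j) → q ℕ.∣ c i j
  down {q} i≢j q∣ = subst (q ℕ.∣_) (c≡det _ _ i≢j) (∣⇒∣ᵤ q∣)
  ad∧bd : ∀ {q} → q ℕ.∣ _ → q ℕ.∣ _ → q ℕ.∣ _
  ad∧bd q∣ad q∣bd = down a<b (det-∣-trans a d b (prim _) (up a<d q∣ad) (det-∣-sym b d (up b<d q∣bd)))
  ab∧ad : ∀ {q} → q ℕ.∣ _ → q ℕ.∣ _ → q ℕ.∣ _
  ab∧ad q∣ad q∣ab = down b<d (det-∣-trans b a d (prim _) (det-∣-sym a b (up a<b q∣ab)) (up a<d q∣ad))

-- Necessity: the prime condition by counting slopes modulo p

prime-inverse : ∀ {p} → Prime p → ∀ x → ¬ (+ p ∣ x) → ∃[ z ] + p ∣ z * x - 1ℤ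
prime-inverse {p} pr x p∤x with bézout x (+ p)
... | s , t , eq with prime⇒irreducible pr (gcd[m,n]∣n ∣ x ∣ p)
...   | inj₂ g≡p = contradiction (∣ᵤ⇒∣ (subst (ℕ._∣ ∣ x ∣) g≡p (gcd[m,n]∣m ∣ x ∣ p))) p∤x
...   | inj₁ g≡1 = s , divides (- t) (trans (cong (λ y → s * x - y) (sym (trans eq (cong +_ g≡1)))) (lemma s x t (+ p)))
  where
  lemma : ∀ s x t p → s * x - (s * x + t * p) ≡ - t * p
  lemma = solve-∀

%ℕ-≡⇒∣ : ∀ a b p .{{_ : ℕ.NonZero p}} → a %ℕ p ≡ b %ℕ p → + p ∣ a - b
%ℕ-≡⇒∣ a b p eq = divides (a /ℕ p - b /ℕ p)
  (trans (cong₂ _-_ (a≡a%ℕn+[a/ℕn]*n a p) (trans (a≡a%ℕn+[a/ℕn]*n b p) (cong (λ r → + r + (b /ℕ p) * + p) (sym eq))))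
         (lemma (+ (a %ℕ p)) (a /ℕ p) (b /ℕ p) (+ p)))
  where
  lemma : ∀ r x y p → r + x * p - (r + y * p) ≡ (x - y) * p
  lemma = solve-∀

-- As `i` and `j` invert `x` and `y` modulo `p`, the two remainders are the slopes u/x and v/y in
-- 𝔽ₚ; multiplying by xy clears the denominators.
congruent-slopes : ∀ p .{{_ : ℕ.NonZero p}} x y u v i j → + p ∣ i * x - 1ℤ → + p ∣ j * y - 1ℤ →
                   (u * i) %ℕ p ≡ (v * j) %ℕ p → + p ∣ v * x - u * y
congruent-slopes p x y u v i j ix jy eq = subst (+ p ∣_) (lemma x y u v i j)
  (∣m∣n⇒∣m+n (∣m∣n⇒∣m-n (∣n⇒∣m*n (u * y) ix) (∣n⇒∣m*n (v * x) jy))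
             (∣n⇒∣m*n (- (x * y)) (%ℕ-≡⇒∣ (u * i) (v * j) p eq)))
  where
  lemma : ∀ x y u v i j → u * y * (i * x - 1ℤ) - v * x * (j * y - 1ℤ) + - (x * y) * (u * i - v * j) ≡ v * x - u * y
  lemma = solve-∀

pigeonhole-contradiction : ∀ {p} (f : Fin (suc p) → Fin p) → ¬ (∀ a b → a F.< b → f a ≢ f b)
pigeonhole-contradiction {p} f inj with F.pigeonhole (ℕ.n<1+n p) f
... | a , b , a<b , eq = inj a b a<b eq

module _ {p e} (pr : Prime p) (w : Fin (suc p) → V) (prim : ∀ i → Primitive (w i))
         (val : ∀ i j → i F.< j → HasValuation p ∣ det (w i) (w j) ∣ (suc e)) where
  private
    instance _ = prime⇒nonZero pr
    q = p ℕ.^ suc e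
    t = proj₁ (prim F.zero)

    -- Coordinates in the basis `w F.zero`, `t` of determinant 1: `w a` is `X a` times `w F.zero`
    -- plus `Y a` times `t`.
    X Y : Fin (suc p) → ℤ
    X a = det (w a) t
    Y a = det (w F.zero) (w a)

    q∣Y : ∀ a → + q ∣ Y a
    q∣Y F.zero    = subst (+ q ∣_) (sym (det-self (w F.zero))) (divides 0ℤ refl)
    q∣Y (F.suc a) = ∣ᵤ⇒∣ (proj₁ (val F.zero (F.suc a) (s≤s z≤n)))

    -- Since `p` divides `Y a`, dividing `X a` too would make `w a` vanish modulo `p`, against its
    -- primitivity.
    p∤X : ∀ a → ¬ (+ p ∣ X a)
    p∤X a p∣X with prim a
    ... | s , eq = prime∤1 pr (subst (+ p ∣_) (cong₂ _*_ (proj₂ (prim F.zero)) eq)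
      (∣m+n∣n⇒∣m {m = det (w F.zero) t * det (w a) s}
        (subst (+ p ∣_) (det-plücker (w F.zero) (w a) s t) (∣n⇒∣m*n (det (w F.zero) s) p∣X))
        (∣m⇒∣m*n (det s t) (∣-trans (∣ᵤ⇒∣ (ℕ.m∣m*n (p ℕ.^ e))) (q∣Y a)))))

    u : Fin (suc p) → ℤ
    u a = quotient (q∣Y a)

    X⁻¹ : Fin (suc p) → ℤ
    X⁻¹ a = proj₁ (prime-inverse pr (X a) (p∤X a))

    -- The slope (Y a / q) / X a in 𝔽ₚ.
    slope : Fin (suc p) → Fin p
    slope a = F.fromℕ< (n%ℕd<d (u a * X⁻¹ a) p)

    inv : ∀ a → + p ∣ X⁻¹ a * X a - 1ℤ
    inv a = proj₂ (prime-inverse pr (X a) (p∤X a))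

    -- The determinant in the coordinates `X`, `Y`, with the common factor `q` of the second
    -- coordinates taken out.
    det≡ : ∀ a b → det (w a) (w b) ≡ (u b * X a - u a * X b) * + q
    det≡ a b = begin
      det (w a) (w b) ≡⟨ lemma₂ (det (w a) (w b)) (Y a * X b) ⟩
      1ℤ * det (w a) (w b) + Y a * X b - Y a * X b
        ≡⟨ cong (λ z → z * det (w a) (w b) + Y a * X b - Y a * X b) (proj₂ (prim F.zero)) ⟨
      det (w F.zero) t * det (w a) (w b) + Y a * X b - Y a * X b
        ≡⟨ cong (_- Y a * X b) (det-plücker (w F.zero) (w a) (w b) t) ⟨
      Y b * X a - Y a * X b
        ≡⟨ cong₂ (λ y z → y * X a - z * X b) (_∣_.equality (q∣Y b)) (_∣_.equality (q∣Y a)) ⟩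
      u b * + q * X a - u a * + q * X b ≡⟨ lemma₃ (X a) (X b) (u a) (u b) (+ q) ⟩
      (u b * X a - u a * X b) * + q ∎
      where
      open ≡-Reasoning
      lemma₂ : ∀ d y → d ≡ 1ℤ * d + y - y
      lemma₂ = solve-∀
      lemma₃ : ∀ x y u v q → v * q * x - u * q * y ≡ (v * x - u * y) * q
      lemma₃ = solve-∀

    -- Equal slopes make the cofactor of `q` in `det≡` divisible by `p`, which pushes the valuation
    -- above `suc e`.
    slope-injective : ∀ a b → a F.< b → slope a ≢ slope b
    slope-injective a b a<b eq = proj₂ (val a b a<b) (pq∣ (det≡ a b)
      (congruent-slopes p (X a) (X b) (u a) (u b) (X⁻¹ a) (X⁻¹ b) (inv a) (inv b)
      (F.fromℕ<-injective ((u a * X⁻¹ a) %ℕ p) ((u b * X⁻¹ b) %ℕ p)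
         (n%ℕd<d (u a * X⁻¹ a) p) (n%ℕd<d (u b * X⁻¹ b) p) eq)))
      where
      pq∣ : ∀ {d x} → d ≡ x * + q → + p ∣ x → p ℕ.* q ℕ.∣ ∣ d ∣
      pq∣ {d} {x} eq p∣x = subst (p ℕ.* q ℕ.∣_) (sym (trans (cong ∣_∣ eq) (ℤ.abs-* x (+ q)))) (ℕ.*-monoˡ-∣ q (∣⇒∣ᵤ p∣x))

  equal-valuations-impossible : ⊥
  equal-valuations-impossible = pigeonhole-contradiction slope slope-injective

realisable⇒prime : ∀ {n} {c : Labels n} {v} → Realises c v → PrimeCondition c
realisable⇒prime {c = c} {v} (c≡det , prim) p pr _ f f↑
  with F.all? (λ i → F.all? (λ j → (i F.<? j) →-dec ¬? (p ℕ.∣? c (f i) (f j))))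
... | yes all∤ = inj₁ all∤
... | no ¬all∤ = inj₂ λ where
  -- A common valuation 0 belongs to the first alternative, which is excluded in this branch.
  (zero , val) → ¬all∤ λ i j i<j p∣ → proj₂ (val i j i<j) (subst (ℕ._∣ c (f i) (f j)) (sym (ℕ.*-identityʳ p)) p∣)
  (suc e , val) → equal-valuations-impossible {e = e} pr (v ∘ f) (prim ∘ f) λ i j i<j →
    subst (λ x → HasValuation p x (suc e)) (sym (c≡det (f i) (f j) λ eq → F.<-irrefl eq (f↑ i j i<j))) (val i j i<j)

-- Necessity: Conway-Coxeter friezes as determinants of primitive vectors

module _ {m e} (cc : IsConwayCoxeter (suc (suc m)) e) where
  open IsConwayCoxeter cc
  open Signed e frieze

  private
    D≡1 : ∀ {i j} → suc (toℕ i) ≡ toℕ j → D i j ≡ 1ℤ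
    D≡1 {i} {j} eq = trans (D-< {i} {j} (ℕ.≤-reflexive eq)) (cong +_ (boundary i j eq))

    det≡D : ∀ i j → det (vec i) (vec j) ≡ D i j
    det≡D i j = trans (det-vec i j) (trans (cong (_* D i j) (D≡1 {o₀} {o₁} refl)) (ℤ.*-identityˡ (D i j)))

  -- The edge between the first two vertices has label 1, so the constant factor in `det-vec`
  -- disappears. Every vector is primitive because a boundary neighbour has determinant 1 with it,
  -- up to sign.
  conwayCoxeter-realised : Realises e vec
  conwayCoxeter-realised = (λ i j i≢j → trans (cong ∣_∣ (det≡D i j)) (∣D∣ i j i≢j)) , prim
    where
    prim : ∀ i → Primitive (vec i)
    prim F.zero    = vec o₁ , trans (det≡D o₀ o₁) (D≡1 {o₀} {o₁} refl)
    -- The neighbour used here is the predecessor, whose determinant has the opposite sign; hence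
    -- the negated vector.
    prim (F.suc i) = (- proj₁ (vec j) , - proj₂ (vec j)) ,
      trans (lemma (D o₀ (F.suc i)) (D o₁ (F.suc i)) (D o₀ j) (D o₁ j))
        (trans (sym (det-antisym (vec j) (vec (F.suc i))))
          (trans (det≡D j (F.suc i)) (D≡1 {j} {F.suc i} (cong suc (F.toℕ-inject₁ i)))))
      where
      j = F.inject₁ i
      lemma : ∀ a b c d → a * - d - b * - c ≡ - (a * d - b * c)
      lemma = solve-∀

-- Cyclic order constrains triples only, so each pair is completed to one: 0 and 1 by 2, any other
-- pair containing 0 by 1, and a pair without 0 by 0.
cyclic⇒injective : ∀ {n m} (g : Fin (suc (suc (suc n))) → Fin m) → CyclicOrderPreserving g →
                   ∀ i j → i F.< j → g i ≢ g j
cyclic⇒injective g cyc i j i<j = from i j i<j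
  where
  distinct : ∀ i j k → i F.< j → j F.< k → g i ≢ g j × g j ≢ g k × g i ≢ g k
  distinct i j k i<j j<k with cyc i j k i<j j<k
  ... | inj₁ (p , q)        = F.<⇒≢ p , F.<⇒≢ q , F.<⇒≢ (F.<-trans p q)
  ... | inj₂ (inj₁ (p , q)) = F.<⇒≢ (F.<-trans p q) ∘ sym , F.<⇒≢ p , F.<⇒≢ q ∘ sym
  ... | inj₂ (inj₂ (p , q)) = F.<⇒≢ q , F.<⇒≢ (F.<-trans p q) ∘ sym , F.<⇒≢ p ∘ sym
  from : ∀ i j → i F.< j → g i ≢ g j
  from F.zero (F.suc F.zero) _ =
    proj₁ (distinct F.zero (F.suc F.zero) (F.suc (F.suc F.zero)) (s≤s z≤n) (s≤s (s≤s z≤n)))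
  from F.zero j@(F.suc (F.suc _)) _ = proj₂ (proj₂ (distinct F.zero (F.suc F.zero) j (s≤s z≤n) (s≤s (s≤s z≤n))))
  from i@(F.suc _) j i<j = proj₁ (proj₂ (distinct F.zero i j (s≤s z≤n) i<j))

appears⇒realised : ∀ {n} (c : Labels (suc (suc (suc n)))) → AppearsInCC c → ∃[ v ] Realises c v
appears⇒realised c (zero , _ , _ , cc , _) with () ← IsConwayCoxeter.atLeast3 cc
appears⇒realised c (suc zero , _ , _ , cc , _) with s≤s () ← IsConwayCoxeter.atLeast3 cc
appears⇒realised c (suc (suc m) , e , g , cc , cyc , c≡e) with conwayCoxeter-realised cc
... | e≡det , prim = Signed.vec e (IsConwayCoxeter.frieze cc) ∘ g ,
  (λ i j i≢j → trans (e≡det (g i) (g j) (inj i j i≢j)) (sym (c≡e i j i≢j))) , prim ∘ g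
  where
  inj : ∀ i j → i ≢ j → g i ≢ g j
  inj i j i≢j with F.<-cmp i j
  ... | tri< i<j _ _ = cyclic⇒injective g cyc i j i<j
  ... | tri≈ _ i≡j _ = contradiction i≡j i≢j
  ... | tri> _ _ j<i = cyclic⇒injective g cyc j i j<i ∘ sym

-- Unimodular refinement of a fan

infix 4 _◁_

-- Counterclockwise order of rays in the upper half-plane. The weak inequality admits the positive
-- horizontal axis as first ray.
_◁_ : V → V → Set
u ◁ w = (0ℤ ℤ.≤ proj₂ u) × (0ℤ ℤ.< proj₂ w) × (0ℤ ℤ.< det u w)

+-nonNeg-pos : ∀ {a b} → 0ℤ ℤ.≤ a → 0ℤ ℤ.< b → 0ℤ ℤ.< a + b
+-nonNeg-pos 0≤a 0<b = ℤ.+-mono-≤-< 0≤a 0<b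

*-nonNeg : ∀ {a b} → 0ℤ ℤ.≤ a → 0ℤ ℤ.≤ b → 0ℤ ℤ.≤ a * b
*-nonNeg {+ m} {+ n} _ _ = subst (0ℤ ℤ.≤_) (ℤ.pos-* m n) (ℤ.+≤+ z≤n)

*-pos : ∀ {a b} → 0ℤ ℤ.< a → 0ℤ ℤ.< b → 0ℤ ℤ.< a * b
*-pos {+ suc m} {+ suc n} _ _ = ℤ.+<+ (s≤s z≤n)
*-pos {+ zero} (ℤ.+<+ ())
*-pos {+ suc _} {+ zero} _ (ℤ.+<+ ())

pos-cancelˡ : ∀ {a b} → 0ℤ ℤ.< a → 0ℤ ℤ.< a * b → 0ℤ ℤ.< b
pos-cancelˡ {+ suc n} {b} _ 0<ab =
  ℤ.*-cancelˡ-<-nonNeg (+ suc n) (subst (ℤ._< + suc n * b) (sym (ℤ.*-zeroʳ (+ suc n))) 0<ab)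
pos-cancelˡ {+ zero} (ℤ.+<+ ())

-- Second coordinate of Cramer's rule: `det u w` times `z` is `det z w` times `u` plus `det u z`
-- times `w`.
det-expand : ∀ u w z → det u w * proj₂ z ≡ det z w * proj₂ u + det u z * proj₂ w
det-expand (a , b) (c , d) (e , f) = lemma a b c d e f
  where
  lemma : ∀ a b c d e f → (a * d - b * c) * f ≡ (e * d - f * c) * b + (a * f - b * e) * d
  lemma = solve-∀

-- By Cramer's rule for the middle ray, `det u w` times the positive height of `v` is a nonnegative
-- term plus a positive one.
◁-trans : ∀ {u v w} → u ◁ v → v ◁ w → u ◁ w
◁-trans {u} {v} {w} (0≤u , 0<v , uv) (_ , 0<w , vw) = 0≤u , 0<w ,
  pos-cancelˡ 0<v (subst (0ℤ ℤ.<_) (trans (sym (det-expand u w v)) (ℤ.*-comm (det u w) (proj₂ v)))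
    (+-nonNeg-pos (*-nonNeg {det v w} (ℤ.<⇒≤ vw) 0≤u) (*-pos {det u v} uv 0<w)))

-- Consecutive rays bound unimodular sectors. The final height 1 is the determinant with the ray (1,
-- 0), and so becomes the label of the closing edge.
data Fan : List V → Set where
  last : ∀ {w} → proj₂ w ≡ 1ℤ → Fan (w ∷ [])
  cons : ∀ {u w ws} → 0ℤ ℤ.≤ proj₂ u → 0ℤ ℤ.< proj₂ w → det u w ≡ 1ℤ → Fan (w ∷ ws) → Fan (u ∷ w ∷ ws)

fan-◁ : ∀ {ws} → Fan ws → ∀ i j → i F.< j → lookup ws i ◁ lookup ws j
fan-◁ (last _) F.zero F.zero ()
fan-◁ (cons {u} {w} {ws} 0≤u 0<w uw fan) F.zero (F.suc j) _ = from j
  where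
  u◁w : u ◁ w
  u◁w = 0≤u , 0<w , subst (0ℤ ℤ.<_) (sym uw) (ℤ.+<+ (s≤s z≤n))
  from : ∀ j → u ◁ lookup (w ∷ ws) j
  from F.zero    = u◁w
  from (F.suc j) = ◁-trans {u} {w} u◁w (fan-◁ fan F.zero (F.suc j) (s≤s z≤n))
fan-◁ (cons _ _ _ fan) (F.suc i) (F.suc j) (s≤s i<j) = fan-◁ fan i j i<j

fan-adjacent : ∀ {ws} → Fan ws → ∀ i j → suc (toℕ i) ≡ toℕ j → det (lookup ws i) (lookup ws j) ≡ 1ℤ
fan-adjacent (last _) F.zero F.zero ()
fan-adjacent (cons _ _ uw _) F.zero (F.suc F.zero) _ = uw
fan-adjacent (cons _ _ _ fan) (F.suc i) (F.suc j) eq = fan-adjacent fan i j (ℕ.suc-injective eq)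

fan-last : ∀ {ws} → Fan ws → ∀ j → suc (toℕ j) ≡ length ws → proj₂ (lookup ws j) ≡ 1ℤ
fan-last (last y≡1) F.zero _ = y≡1
fan-last (cons _ _ _ fan) (F.suc j) eq = fan-last fan j (ℕ.suc-injective eq)

-- The new ray z is chosen with det u z = 1 and det z w reduced modulo det u w.
intermediate : ∀ u w d → Primitive u → Primitive w → 0ℤ ℤ.≤ proj₂ u → 0ℤ ℤ.< proj₂ w →
  det u w ≡ + suc (suc d) →
  ∃₂ λ z r → det u z ≡ 1ℤ × det z w ≡ + suc r × suc r ℕ.< suc (suc d) × 0ℤ ℤ.< proj₂ z
intermediate u@(a , b) w@(c , e) d (z₀@(f , g) , uz₀) (s , ws) 0≤u 0<w uw = go r refl
  where
  m = suc (suc d)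
  k = det z₀ w /ℕ m
  r = det z₀ w %ℕ m
  z : V
  z = f - k * a , g - k * b
  uz : det u z ≡ 1ℤ
  uz = trans (lemma a b f g k) uz₀
    where
    lemma : ∀ a b f g k → a * (g - k * b) - b * (f - k * a) ≡ a * g - b * f
    lemma = solve-∀
  zw : det z w ≡ + r
  zw = trans (lemma a b c e f g k)
    (trans (cong₂ (λ x y → x - k * y) (a≡a%ℕn+[a/ℕn]*n (det z₀ w) m) uw) (lemma₂ (+ r) (k * + m)))
    where
    lemma : ∀ a b c e f g k → (f - k * a) * e - (g - k * b) * c ≡ (f * e - g * c) - k * (a * e - b * c)
    lemma = solve-∀
    lemma₂ : ∀ r x → r + x - x ≡ r
    lemma₂ = solve-∀
  -- By Cramer's rule `m` times `z` is `r` times `u` plus `w`, which forces a positive height of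
  -- `z`.
  y : + m * proj₂ z ≡ + r * b + e
  y = trans (cong (_* proj₂ z) (sym uw)) (trans (det-expand u w z)
        (cong₂ (λ x y → x * b + y) zw (trans (cong (_* e) uz) (ℤ.*-identityˡ e))))
  go : ∀ r′ → r′ ≡ r → ∃₂ λ z r → det u z ≡ 1ℤ × det z w ≡ + suc r × suc r ℕ.< suc (suc d) × 0ℤ ℤ.< proj₂ z
  -- Remainder 0 would make `z` parallel to `w`; then `m`, which is at least 2, would divide
  -- `det u z` times `det w s`, that is 1.
  go zero 0≡r = contradiction (ℕ.∣1⇒≡1 (∣⇒∣ᵤ (divides (det z s) one))) λ ()
    where
    one : 1ℤ ≡ det z s * + m
    one = begin
      1ℤ                                ≡⟨⟩
      0ℤ + 1ℤ * 1ℤ                      ≡⟨ cong₂ _+_ (ℤ.*-zeroʳ (det u s)) (cong₂ _*_ uz ws) ⟨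
      det u s * 0ℤ + det u z * det w s  ≡⟨ cong (λ x → det u s * x + det u z * det w s) (trans zw (cong +_ (sym 0≡r))) ⟨
      det u s * det z w + det u z * det w s ≡⟨ det-plücker u z w s ⟨
      det u w * det z s                 ≡⟨ cong (_* det z s) uw ⟩
      + m * det z s                     ≡⟨ ℤ.*-comm (+ m) (det z s) ⟩
      det z s * + m                     ∎
      where open ≡-Reasoning
  go (suc r′) eq = z , r′ , uz , trans zw (cong +_ (sym eq)) , subst (ℕ._< m) (sym eq) (n%ℕd<d (det z₀ w) m) ,
    pos-cancelˡ {+ m} (ℤ.+<+ (s≤s z≤n)) (subst (0ℤ ℤ.<_) (sym y) (+-nonNeg-pos (*-nonNeg {+ r} (ℤ.+≤+ z≤n) 0≤u) 0<w))

infix 4 _↪_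

record _↪_ {n m} (v : Fin n → V) (w : Fin m → V) : Set where
  field
    index      : Fin n → Fin m
    increasing : StrictlyIncreasing index
    agree      : ∀ i → w (index i) ≡ v i

open _↪_

det≡1⇒primitive : ∀ u z → det u z ≡ 1ℤ → Primitive z
det≡1⇒primitive (a , b) (e , f) uz = (- a , - b) , trans (lemma a b e f) uz
  where
  lemma : ∀ a b e f → e * - b - f * - a ≡ a * f - b * e
  lemma = solve-∀

-- Descent on the determinant: the intermediate ray `z` splits off a unimodular sector next to `u`,
-- and the remaining sector from `z` to `w` has a smaller determinant.
refine : ∀ {d} → Acc ℕ._<_ d → ∀ u w ws → Primitive u → Primitive w → 0ℤ ℤ.≤ proj₂ u → 0ℤ ℤ.< proj₂ w →
  det u w ≡ + suc d → Fan (w ∷ ws) → ∃[ us ] Fan (u ∷ us) × lookup (w ∷ ws) ↪ lookup us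
refine {zero} _ u w ws _ _ 0≤u 0<w uw fan = w ∷ ws , cons 0≤u 0<w uw fan ,
  record { index = id ; increasing = λ _ _ i<j → i<j ; agree = λ _ → refl }
refine {suc d} (acc rec) u w ws pu pw 0≤u 0<w uw fan
  with z , r , uz , zw , s≤s r<d , 0<z ← intermediate u w d pu pw 0≤u 0<w uw
  with us , fan′ , emb ← refine (rec r<d) z w ws (det≡1⇒primitive u z uz) pw (ℤ.<⇒≤ 0<z) 0<w zw fan
  = z ∷ us , cons 0≤u 0<z uz fan′ ,
    record { index = F.suc ∘ index emb ; increasing = λ i j i<j → s≤s (increasing emb i j i<j) ; agree = agree emb }

positive⇒suc : ∀ {a} → 0ℤ ℤ.< a → ∃[ d ] a ≡ + suc d
positive⇒suc {+ suc d} _ = d , refl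
positive⇒suc {+ zero} (ℤ.+<+ ())

-- A ray at height 1 far enough to the left closes the fan.
closing : ∀ u → 0ℤ ℤ.< proj₂ u → ∃[ x ] 0ℤ ℤ.< det u (x , 1ℤ)
closing (a , + suc b) 0<y = - (1ℤ - k) , subst (0ℤ ℤ.<_) (sym eq) (+-nonNeg-pos {+ r} (ℤ.+≤+ z≤n) 0<y)
  where
  k = a /ℕ suc b
  r = a %ℕ suc b
  lemma : ∀ r k y → (r + k * y) * 1ℤ - y * (- (1ℤ - k)) ≡ r + y
  lemma = solve-∀
  eq : a * 1ℤ - + suc b * (- (1ℤ - k)) ≡ + r + + suc b
  eq = trans (cong (λ x → x * 1ℤ - + suc b * (- (1ℤ - k))) (a≡a%ℕn+[a/ℕn]*n a (suc b))) (lemma (+ r) k (+ suc b))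
closing (_ , + zero) (ℤ.+<+ ())

-- A fan grows at its front, so the sectors are treated from the last to the first, beginning with
-- the one between the last vector and a closing ray.
refineAll : ∀ n (v : Fin (suc n) → V) → (∀ i → Primitive (v i)) → (∀ i j → i F.< j → v i ◁ v j) →
  0ℤ ℤ.< proj₂ (v (F.fromℕ n)) → ∃[ ws ] Fan (v F.zero ∷ ws) × v ↪ lookup (v F.zero ∷ ws)
refineAll zero v prim _ 0<y
  with x , 0<d ← closing (v F.zero) 0<y
  with d , eq ← positive⇒suc 0<d
  with us , fan , _ ← refine (<-wellFounded d) (v F.zero) (x , 1ℤ) [] (prim F.zero)
                        (det≡1⇒primitive (1ℤ , 0ℤ) (x , 1ℤ) refl)
                        (ℤ.<⇒≤ 0<y) (ℤ.+<+ (s≤s z≤n)) eq (last refl)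
  = us , fan , record { index = λ _ → F.zero ; increasing = λ { F.zero F.zero () } ; agree = λ { F.zero → refl } }
refineAll (suc n) v prim v◁ 0<y
  with ws , fan , emb ← refineAll n (v ∘ F.suc) (prim ∘ F.suc) (λ i j i<j → v◁ (F.suc i) (F.suc j) (s≤s i<j)) 0<y
  with 0≤u , 0<w , 0<d ← v◁ F.zero (F.suc F.zero) (s≤s z≤n)
  with d , eq ← positive⇒suc 0<d
  with us , fan′ , emb′ ← refine (<-wellFounded d) (v F.zero) (v (F.suc F.zero)) ws (prim _) (prim _) 0≤u 0<w eq fan
  = us , fan′ , record
    { index      = λ { F.zero → F.zero ; (F.suc i) → F.suc (index emb′ (index emb i)) }
    ; increasing = λ { F.zero (F.suc _) _ → s≤s z≤n
                     ; (F.suc i) (F.suc j) (s≤s i<j) → s≤s (increasing emb′ _ _ (increasing emb i j i<j)) }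
    ; agree      = λ { F.zero → refl ; (F.suc i) → trans (agree emb′ (index emb i)) (agree emb i) } }

-- Conway-Coxeter friezes from fans

det-frieze : ∀ {m} (v : Fin m → V) → (∀ i j → i F.< j → 0ℤ ℤ.< det (v i) (v j)) →
             IsPosFrieze m (λ i j → ∣ det (v i) (v j) ∣)
det-frieze {m} v pos = record
  { symm     = λ i j → trans (cong ∣_∣ (det-antisym (v i) (v j))) (ℤ.∣-i∣≡∣i∣ (det (v j) (v i)))
  ; positive = positive
  -- Increasing indices make all six determinants positive, so the absolute values drop out and the
  -- Plücker relation remains.
  ; ptolemy  = λ i j k l i<j j<k k<l → ℤ.+-injective (begin
      + (∣d∣ i k ℕ.* ∣d∣ j l)                           ≡⟨ ℤ.pos-* (∣d∣ i k) (∣d∣ j l) ⟩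
      + ∣d∣ i k * + ∣d∣ j l                             ≡⟨ cong₂ _*_ (abs (F.<-trans i<j j<k)) (abs (F.<-trans j<k k<l)) ⟩
      det (v i) (v k) * det (v j) (v l)                 ≡⟨ det-plücker (v i) (v j) (v k) (v l) ⟩
      det (v i) (v l) * det (v j) (v k) + det (v i) (v j) * det (v k) (v l)
        ≡⟨ cong₂ _+_ (cong₂ _*_ (abs (F.<-trans i<j (F.<-trans j<k k<l))) (abs j<k)) (cong₂ _*_ (abs i<j) (abs k<l)) ⟨
      + ∣d∣ i l * + ∣d∣ j k + + ∣d∣ i j * + ∣d∣ k l
        ≡⟨ cong₂ _+_ (ℤ.pos-* (∣d∣ i l) (∣d∣ j k)) (ℤ.pos-* (∣d∣ i j) (∣d∣ k l)) ⟨
      + (∣d∣ i l ℕ.* ∣d∣ j k ℕ.+ ∣d∣ i j ℕ.* ∣d∣ k l)   ∎)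
  }
  where
  open ≡-Reasoning
  ∣d∣ : Fin m → Fin m → ℕ
  ∣d∣ i j = ∣ det (v i) (v j) ∣
  abs : ∀ {i j} → i F.< j → + ∣d∣ i j ≡ det (v i) (v j)
  abs {i} {j} i<j = ℤ.0≤i⇒+∣i∣≡i (ℤ.<⇒≤ (pos i j i<j))
  pos< : ∀ i j → i F.< j → 0 ℕ.< ∣d∣ i j
  pos< i j i<j = ℤ.drop‿+<+ (subst (0ℤ ℤ.<_) (sym (abs i<j)) (pos i j i<j))
  positive : ∀ i j → i ≢ j → 0 ℕ.< ∣d∣ i j
  positive i j i≢j with F.<-cmp i j
  ... | tri< i<j _ _ = pos< i j i<j
  ... | tri≈ _ i≡j _ = contradiction i≡j i≢j
  ... | tri> _ _ j<i = subst (0 ℕ.<_)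
          (trans (cong ∣_∣ (det-antisym (v j) (v i))) (ℤ.∣-i∣≡∣i∣ (det (v i) (v j)))) (pos< j i j<i)

fan-conwayCoxeter : ∀ ws → Fan ((1ℤ , 0ℤ) ∷ ws) → 2 ℕ.≤ length ws →
  IsConwayCoxeter (suc (length ws)) (λ i j → ∣ det (lookup ((1ℤ , 0ℤ) ∷ ws) i) (lookup ((1ℤ , 0ℤ) ∷ ws) j) ∣)
fan-conwayCoxeter ws fan 2≤ = record
  { atLeast3   = s≤s 2≤
  ; frieze     = det-frieze (lookup ((1ℤ , 0ℤ) ∷ ws)) (λ i j i<j → proj₂ (proj₂ (fan-◁ fan i j i<j)))
  ; boundary   = λ i j eq → cong ∣_∣ (fan-adjacent fan i j eq)
  ; boundaryWr = λ { F.zero j _ eq → cong ∣_∣ (trans (det-axis (lookup ((1ℤ , 0ℤ) ∷ ws) j)) (fan-last fan j eq)) }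
  }

module _ {n} (c : Labels (suc (suc (suc n)))) (v : Fin (suc (suc (suc n))) → V) (v₀ : v F.zero ≡ (1ℤ , 0ℤ))
         (pos : ∀ i j → i F.< j → 0ℤ ℤ.< det (v i) (v j)) where
  private
    height≡ : ∀ i → det (v F.zero) (v i) ≡ proj₂ (v i)
    height≡ i = trans (cong (λ u → det u (v i)) v₀) (det-axis (v i))
    height>0 : ∀ j (i : Fin (suc (suc (suc n)))) → i F.< j → 0ℤ ℤ.< proj₂ (v j)
    height>0 (F.suc j) _ _ = subst (0ℤ ℤ.<_) (height≡ (F.suc j)) (pos F.zero (F.suc j) (s≤s z≤n))
    height≥0 : ∀ i → 0ℤ ℤ.≤ proj₂ (v i)
    height≥0 F.zero    = ℤ.≤-reflexive (sym (cong proj₂ v₀))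
    height≥0 (F.suc i) = ℤ.<⇒≤ (height>0 (F.suc i) F.zero (s≤s z≤n))
    2≤ : ∀ {ws : List V} → v ↪ lookup (v F.zero ∷ ws) → 2 ℕ.≤ length ws
    2≤ emb = ℕ.s≤s⁻¹ (ℕ.≤-trans (s≤s (ℕ.≤-trans (s≤s (ℕ.≤-trans (s≤s z≤n) g₀<g₁)) g₁<g₂))
                                (F.toℕ<n (index emb (F.suc (F.suc F.zero)))))
      where
      g₀<g₁ = increasing emb F.zero (F.suc F.zero) (s≤s z≤n)
      g₁<g₂ = increasing emb (F.suc F.zero) (F.suc (F.suc F.zero)) (s≤s (s≤s z≤n))

  realised⇒appears : Realises c v → AppearsInCC c
  realised⇒appears (c≡det , prim) = embed
    (refineAll (suc (suc n)) v prim (λ i j i<j → height≥0 i , height>0 j i i<j , pos i j i<j)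
      (height>0 (F.fromℕ (suc (suc n))) F.zero (s≤s z≤n)))
    where
    embed : ∃[ ws ] Fan (v F.zero ∷ ws) × v ↪ lookup (v F.zero ∷ ws) → AppearsInCC c
    embed (ws , fan , emb) =
      suc (length ws) , (λ i j → ∣ det (lookup (v F.zero ∷ ws) i) (lookup (v F.zero ∷ ws) j) ∣) , index emb ,
      subst (λ u → IsConwayCoxeter (suc (length ws)) (λ i j → ∣ det (lookup (u ∷ ws) i) (lookup (u ∷ ws) j) ∣)) (sym v₀)
        (fan-conwayCoxeter ws (subst (λ u → Fan (u ∷ ws)) v₀ fan) (2≤ emb)) ,
      (λ i j k i<j j<k → inj₁ (increasing emb i j i<j , increasing emb j k j<k)) ,
      λ i j i≢j → trans (sym (c≡det i j i≢j)) (sym (cong₂ (λ u w → ∣ det u w ∣) (agree emb i) (agree emb j)))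

-- From the two conditions to primitive vectors

insert : ∀ {k n} (f : Fin k → Fin n) → StrictlyIncreasing f → ∀ x → (∀ i → f i ≢ x) →
  ∃[ h ] StrictlyIncreasing {suc k} {n} h × (∀ i → h i ≡ x ⊎ (∃[ j ] h i ≡ f j))
insert {zero} f _ x _ = (λ _ → x) , (λ { F.zero F.zero () }) , λ _ → inj₁ refl
insert {suc k} {n} f f↑ x x∉f with F.<-cmp x (f F.zero)
... | tri≈ _ x≡f₀ _ = contradiction (sym x≡f₀) (x∉f F.zero)
... | tri< x<f₀ _ _ = h , h↑ , λ { F.zero → inj₁ refl ; (F.suc i) → inj₂ (i , refl) }
  where
  h : Fin (suc (suc k)) → Fin n
  h F.zero    = x
  h (F.suc i) = f i
  h↑ : StrictlyIncreasing h
  h↑ F.zero (F.suc F.zero) _              = x<f₀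
  h↑ F.zero (F.suc (F.suc j)) _           = F.<-trans x<f₀ (f↑ F.zero (F.suc j) (s≤s z≤n))
  h↑ (F.suc i) (F.suc j) (s≤s i<j)        = f↑ i j i<j
... | tri> _ _ f₀<x with insert (f ∘ F.suc) (λ i j i<j → f↑ (F.suc i) (F.suc j) (s≤s i<j)) x (x∉f ∘ F.suc)
...   | h′ , h′↑ , from = h , h↑ , λ { F.zero → inj₂ (F.zero , refl)
                                     ; (F.suc i) → Sum.map₂ (λ { (j , eq) → F.suc j , eq }) (from i) }
  where
  h : Fin (suc (suc k)) → Fin n
  h F.zero    = f F.zero
  h (F.suc i) = h′ i
  h↑ : StrictlyIncreasing h
  h↑ F.zero (F.suc j) _ with from j
  ... | inj₁ eq       = subst (f F.zero F.<_) (sym eq) f₀<x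
  ... | inj₂ (l , eq) = subst (f F.zero F.<_) (sym eq) (f↑ F.zero (F.suc l) (s≤s z≤n))
  h↑ (F.suc i) (F.suc j) (s≤s i<j) = h′↑ i j i<j

-- `PrimeCondition` speaks of increasing selections, whereas the vertices chosen later are indexed
-- by residues modulo p.
sort : ∀ {k n} (f : Fin k → Fin n) → (∀ {i j} → f i ≡ f j → i ≡ j) →
       ∃[ h ] StrictlyIncreasing {k} {n} h × (∀ i → ∃[ j ] h i ≡ f j)
sort {zero} f _ = f , (λ ()) , λ ()
sort {suc k} f inj with sort (f ∘ F.suc) (F.suc-injective ∘ inj)
... | h , h↑ , from with insert h h↑ (f F.zero) (λ i eq → case inj (trans (sym eq) (proj₂ (from i))) of λ ())
...   | h′ , h′↑ , from′ = h′ , h′↑ , λ i →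
  Sum.[ (λ eq → F.zero , eq) , (λ { (j , eq) → F.suc (proj₁ (from j)) , trans eq (proj₂ (from j)) }) ] (from′ i)

no-equidistant : ∀ {n} {c : Labels n} → PrimeCondition c → ∀ {p} → Prime p → ∀ e (f : Fin (suc p) → Fin n) →
  (∀ {a b} → f a ≡ f b → a ≡ b) → ¬ (∀ a b → a ≢ b → HasValuation p (c (f a) (f b)) (suc e))
no-equidistant {c = c} cond {zero} pr = contradiction pr ¬prime[0]
no-equidistant {c = c} cond {suc p} pr e f inj val = refute (sort f inj)
  where
  refute : ¬ (∃[ h ] StrictlyIncreasing {suc (suc p)} h × (∀ i → ∃[ j ] h i ≡ f j))
  refute (h , h↑ , from) = Sum.[ (λ all∤ → all∤ F.zero (F.suc F.zero) (s≤s z≤n)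
                                     (ℕ.∣-trans (ℕ.m∣m*n (suc p ℕ.^ e)) (proj₁ (val′ F.zero (F.suc F.zero) (s≤s z≤n)))))
                               , (λ ¬val → ¬val (suc e , val′)) ]
                             -- The bound on the prime comes from counting: one more than that many
                             -- distinct vertices fit into `Fin n`.
                             (cond (suc p) pr (F.injective⇒≤ inj) h h↑)
    where
    val′ : ∀ i j → i F.< j → HasValuation (suc p) (c (h i) (h j)) (suc e)
    val′ i j i<j = subst₂ (λ x y → HasValuation (suc p) (c x y) (suc e)) (sym (proj₂ (from i))) (sym (proj₂ (from j)))
      (val _ _ λ eq → F.<-irrefl (trans (proj₂ (from i)) (trans (cong f eq) (sym (proj₂ (from j))))) (h↑ i j i<j))

-- Chinese remaindering and valuations

crt : (G : ℕ → ℤ → Set) → (∀ {p s t} → + p ∣ t - s → G p s → G p t) →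
      ∀ ps → All Prime ps → All (λ p → ∃ (G p)) ps → ∃[ s ] All (λ p → G p s) ps
crt G periodic [] [] [] = 0ℤ , []
crt G periodic (p ∷ ps) (pr ∷ prs) ((t , Gt) ∷ Gs) with crt G periodic ps prs Gs
... | s , good with p ℕ.∣? product ps
-- The prime already occurs in `ps`, so `s` is good for it; repeated factors are absorbed here.
...   | yes p∣Q = s , All.lookup good (factorisationHasAllPrimeFactors pr p∣Q prs) ∷ good
-- The product `z * Q` is 1 modulo `p` and 0 modulo every prime in `ps`, so the new value is
-- congruent to `t` and to `s` respectively.
...   | no p∤Q = s + z * Q * (t - s) ,
    periodic (subst (+ p ∣_) (lemma s t z Q) (∣m⇒∣m*n (s - t) (∣m⇒∣-m (proj₂ inv)))) Gt ∷
    All.tabulate (λ {q} q∈ps → periodic (subst (+ q ∣_) (lemma₂ s (z * Q * (t - s)))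
      (∣m⇒∣m*n (t - s) (∣n⇒∣m*n z (∣ᵤ⇒∣ {+ q} {Q} (∈⇒∣product q∈ps))))) (All.lookup good q∈ps))
  where
  Q = + product ps
  inv : ∃[ z ] + p ∣ z * Q - 1ℤ
  inv = prime-inverse pr Q (p∤Q ∘ ∣⇒∣ᵤ)
  z = proj₁ inv
  lemma : ∀ s t z q → - (z * q - 1ℤ) * (s - t) ≡ s + z * q * (t - s) - t
  lemma = solve-∀
  lemma₂ : ∀ s x → x ≡ s + x - s
  lemma₂ = solve-∀

valuation : ∀ {p} → Prime p → ∀ g → .{{ℕ.NonZero g}} → ∃₂ λ v h → g ≡ p ℕ.^ v ℕ.* h × ¬ (p ℕ.∣ h)
valuation {p} pr g = from g (<-wellFounded g)
  where
  from : ∀ g → Acc ℕ._<_ g → .{{ℕ.NonZero g}} → ∃₂ λ v h → g ≡ p ℕ.^ v ℕ.* h × ¬ (p ℕ.∣ h)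
  from g (acc rec) with p ℕ.∣? g
  ... | no p∤g = 0 , g , sym (ℕ.*-identityˡ g) , p∤g
  ... | yes p∣g with from (ℕ.quotient p∣g) (rec (ℕ.quotient-< p∣g {{prime⇒nonTrivial pr}})) {{ℕ.quotient≢0 p∣g}}
  ...   | v , h , eq , p∤h = suc v , h ,
            trans (ℕ.m∣n⇒n≡m*quotient p∣g) (trans (cong (p ℕ.*_) eq) (sym (ℕ.*-assoc p (p ℕ.^ v) h))) , p∤h

hasValuation-* : ∀ {p} → Prime p → ∀ x g v h → g ≡ p ℕ.^ v ℕ.* h →
                 ¬ (p ℕ.∣ h) → ¬ (p ℕ.∣ x) → HasValuation p (x ℕ.* g) v
hasValuation-* {p} pr x g v h g≡ p∤h p∤x = ℕ.∣n⇒∣m*n x (subst (p ℕ.^ v ℕ.∣_) (sym g≡) (ℕ.m∣m*n h)) ,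
  λ d → Sum.[ p∤x , p∤h ] (euclidsLemma x h pr (ℕ.*-cancelˡ-∣ (p ℕ.^ v) {{ℕ.m^n≢0 p v {{prime⇒nonZero pr}}}}
    (subst₂ ℕ._∣_ (ℕ.*-comm p (p ℕ.^ v)) (trans (cong (x ℕ.*_) g≡) (swap x (p ℕ.^ v) h)) d)))
  where
  swap : ∀ x q h → x ℕ.* (q ℕ.* h) ≡ q ℕ.* (x ℕ.* h)
  swap x q h = trans (sym (ℕ.*-assoc x q h)) (trans (cong (ℕ._* h) (ℕ.*-comm x q)) (ℕ.*-assoc q x h))

gcd≡⇒∣ : ∀ {q} x y z w → gcd x y ≡ gcd z w → q ℕ.∣ x → q ℕ.∣ y → (q ℕ.∣ z) × (q ℕ.∣ w)
gcd≡⇒∣ {q} x y z w eq q∣x q∣y = ℕ.∣-trans q∣g (gcd[m,n]∣m z w) , ℕ.∣-trans q∣g (gcd[m,n]∣n z w)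
  where
  q∣g : q ℕ.∣ gcd z w
  q∣g = subst (q ℕ.∣_) eq (gcd-greatest q∣x q∣y)

by-order : ∀ {n} {P : Set} (i j : Fin n) → (i F.< j → P) → (i ≡ j → P) → (j F.< i → P) → P
by-order i j lt eq gt with F.<-cmp i j
... | tri< i<j _ _ = lt i<j
... | tri≈ _ i≡j _ = eq i≡j
... | tri> _ _ j<i = gt j<i

-- Dividing out the gcd of the labels

module Reduction {n} (c : Labels (suc (suc n))) (fr : IsPosFrieze (suc (suc n)) c)
                 (triangle : TriangleCondition c) where
  open Signed c fr

  private
    Vertex = Fin (suc (suc n))

    module _ {q : ℤ} {i j k : Vertex} (i<j : i F.< j) (j<k : j F.< k) where
      f : Fin 3 → Vertex
      f F.zero                   = i
      f (F.suc F.zero)           = j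
      f (F.suc (F.suc F.zero))   = k
      f↑ : StrictlyIncreasing f
      f↑ F.zero (F.suc F.zero) _                         = i<j
      f↑ F.zero (F.suc (F.suc F.zero)) _                 = F.<-trans {i = i} {j} {k} i<j j<k
      f↑ (F.suc F.zero) (F.suc (F.suc F.zero)) _         = j<k
      f↑ (F.suc F.zero) (F.suc F.zero) (s≤s ())
      f↑ (F.suc (F.suc F.zero)) (F.suc (F.suc F.zero)) (s≤s (s≤s ()))
      i<k : i F.< k
      i<k = F.<-trans {i = i} {j} {k} i<j j<k

      up : ∀ {x y} → x F.< y → ∣ q ∣ ℕ.∣ c x y → q ∣ D x y
      up {x} {y} x<y d = ∣ᵤ⇒∣ (subst (∣ q ∣ ℕ.∣_) (sym (∣D∣ x y (F.<⇒≢ x<y))) d)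
      down : ∀ {x y} → x F.< y → q ∣ D x y → ∣ q ∣ ℕ.∣ c x y
      down {x} {y} x<y d = subst (∣ q ∣ ℕ.∣_) (∣D∣ x y (F.<⇒≢ x<y)) (∣⇒∣ᵤ d)

      ij∧jk⇒ik : q ∣ D i j → q ∣ D j k → q ∣ D i k
      ij∧jk⇒ik a b = up i<k
        (proj₂ (gcd≡⇒∣ (c i j) (c j k) (c j k) (c i k) (proj₁ (triangle f f↑)) (down i<j a) (down j<k b)))

      jk∧ik⇒ij : q ∣ D j k → q ∣ D i k → q ∣ D i j
      jk∧ik⇒ij b d = up i<j
        (proj₁ (gcd≡⇒∣ (c j k) (c i k) (c i j) (c i k) (proj₂ (triangle f f↑)) (down j<k b) (down i<k d)))

      ij∧ik⇒jk : q ∣ D i j → q ∣ D i k → q ∣ D j k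
      ij∧ik⇒jk a d = up j<k
        (proj₁ (gcd≡⇒∣ (c i j) (c i k) (c j k) (c i k) (sym (proj₂ (triangle f f↑))) (down i<j a) (down i<k d)))

    q∣0 : ∀ {q} → q ∣ 0ℤ
    q∣0 = divides 0ℤ refl

    D-∣-sym : ∀ {q} i j → q ∣ D i j → q ∣ D j i
    D-∣-sym i j d = subst (_ ∣_) (sym (D-antisym j i)) (∣m⇒∣-m d)

  -- The triangle condition at `o₀`, `i`, `j`. It lets a common divisor of the labels at `o₀` divide
  -- all labels.
  D-∣-opposite : ∀ {q} i j → q ∣ D o₀ i → q ∣ D o₀ j → q ∣ D i j
  D-∣-opposite F.zero j _ d = d
  D-∣-opposite i@(F.suc _) F.zero d _ = D-∣-sym o₀ i d
  D-∣-opposite {q} i@(F.suc _) j@(F.suc _) a b = by-order i j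
    (λ i<j → ij∧ik⇒jk (s≤s z≤n) i<j a b)
    (λ i≡j → subst (q ∣_) (sym (trans (cong (D i) (sym i≡j)) (D-self i))) q∣0)
    (λ j<i → D-∣-sym j i (ij∧ik⇒jk (s≤s z≤n) j<i b a))

  D-∣-trans : ∀ {q} i j → q ∣ D o₀ i → q ∣ D i j → q ∣ D o₀ j
  D-∣-trans F.zero j _ d = d
  D-∣-trans {q} i@(F.suc _) F.zero _ _ = subst (q ∣_) (sym (D-self o₀)) q∣0
  D-∣-trans {q} i@(F.suc _) j@(F.suc _) a b = by-order i j
    (λ i<j → ij∧jk⇒ik (s≤s z≤n) i<j a b)
    (λ i≡j → subst (λ k → q ∣ D o₀ k) i≡j a)
    (λ j<i → jk∧ik⇒ij (s≤s z≤n) j<i (D-∣-sym i j b) a)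

  -- X i plays the role of det (v i) w for a fixed vector w in the lattice spanned by the v k,
  -- where the v k are vectors with D i k = det (v i) (v k).
  record Column (X : Vertex → ℤ) : Set where
    field
      plücker : ∀ i j → X i * D o₀ j - X j * D o₀ i ≡ X o₀ * D i j
      span    : ∀ q j → (∀ k → q ∣ D j k) → q ∣ X j
  open Column

  zero-column : Column (λ _ → 0ℤ)
  zero-column = record { plücker = λ i j → lemma (D o₀ j) (D o₀ i) (D i j) ; span = λ _ _ _ → q∣0 }
    where
    lemma : ∀ x y z → 0ℤ * x - 0ℤ * y ≡ 0ℤ * z
    lemma = solve-∀

  D-column : ∀ k → Column (λ i → D i k)
  D-column k = record { plücker = rel ; span = λ q j d → d k }
    where
    lemma : ∀ x y z w r → y * x ≡ r + z * w → x * y - w * z ≡ r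
    lemma x y z w r eq = trans (cong (_- w * z) (trans (ℤ.*-comm x y) eq)) (lemma′ z w r)
      where
      lemma′ : ∀ z w r → r + z * w - w * z ≡ r
      lemma′ = solve-∀
    rel : ∀ i j → D i k * D o₀ j - D j k * D o₀ i ≡ D o₀ k * D i j
    rel i j = lemma (D i k) (D o₀ j) (D o₀ i) (D j k) (D o₀ k * D i j) (D-plücker o₀ i j k)

  combine : ∀ {X Y} s t → Column X → Column Y → Column (λ i → s * X i + t * Y i)
  combine {X} {Y} s t cX cY = record
    { plücker = λ i j → trans (lemma s t (X i) (X j) (Y i) (Y j) (D o₀ j) (D o₀ i))
        (trans (cong₂ (λ x y → s * x + t * y) (plücker cX i j) (plücker cY i j)) (lemma₂ s t (X o₀) (Y o₀) (D i j)))
    ; span = λ q j d → ∣m∣n⇒∣m+n (∣n⇒∣m*n s (span cX q j d)) (∣n⇒∣m*n t (span cY q j d)) }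
    where
    lemma : ∀ s t x x′ y y′ a b → (s * x + t * y) * a - (s * x′ + t * y′) * b ≡
            s * (x * a - x′ * b) + t * (y * a - y′ * b)
    lemma = solve-∀
    lemma₂ : ∀ s t x y d → s * (x * d) + t * (y * d) ≡ (s * x + t * y) * d
    lemma₂ = solve-∀

  -- Iterated Bézout: columns of `D` are combined with the coefficients that make the entry at `o₀`
  -- a gcd.
  gcd-column : ∀ m (k : Fin m → Vertex) → ∃₂ λ X g → Column X × X o₀ ≡ + g × (∀ a → + g ∣ D o₀ (k a))
  gcd-column zero k = (λ _ → 0ℤ) , 0 , zero-column , refl , λ ()
  gcd-column (suc m) k = extend (gcd-column m (k ∘ F.suc))
    where
    a = D o₀ (k F.zero)
    extend : ∃₂ (λ X g → Column X × X o₀ ≡ + g × (∀ a → + g ∣ D o₀ (k (F.suc a)))) →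
             ∃₂ (λ X g → Column X × X o₀ ≡ + g × (∀ a → + g ∣ D o₀ (k a)))
    extend (X , g , cX , X₀ , g∣) = merge (bézout a (+ g))
      where
      merge : ∃₂ (λ s t → s * a + t * + g ≡ + gcd ∣ a ∣ g) →
              ∃₂ (λ X g → Column X × X o₀ ≡ + g × (∀ a → + g ∣ D o₀ (k a)))
      merge (s , t , eq) = (λ i → s * D i (k F.zero) + t * X i) , gcd ∣ a ∣ g ,
        combine s t (D-column (k F.zero)) cX , trans (cong (λ x → s * a + t * x) X₀) eq ,
        λ { F.zero → ∣ᵤ⇒∣ (gcd[m,n]∣m ∣ a ∣ g)
          ; (F.suc b) → ∣-trans (∣ᵤ⇒∣ {+ gcd ∣ a ∣ g} {+ g} (gcd[m,n]∣n ∣ a ∣ g)) (g∣ b) }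

  -- Dividing by the gcd g of all labels gives vectors in ℤ², each of them primitive.
  record Reduced : Set where
    field
      g       : ℕ
      g≢0     : ℕ.NonZero g
      u       : Vertex → V
      u₀      : u o₀ ≡ (1ℤ , 0ℤ)
      D≡      : ∀ i j → D i j ≡ det (u i) (u j) * + g
      coprime : ∀ i q → q ∣ proj₁ (u i) → q ∣ proj₂ (u i) → q ∣ 1ℤ

  -- The vectors (X j, D o₀ j) have determinants g times `D` by the relation `plücker`, as `X o₀` is
  -- g. Dividing both coordinates by g leaves determinants `D` / g.
  reduced : Reduced
  reduced = from (gcd-column _ id)
    where
    from : ∃₂ (λ X g → Column X × X o₀ ≡ + g × (∀ a → + g ∣ D o₀ a)) → Reduced
    from (X , g , cX , X₀ , g∣D₀) = build (λ j → quotient (g∣X j)) (λ j → quotient (g∣D₀ j))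
                                          (λ j → _∣_.equality (g∣X j)) (λ j → _∣_.equality (g∣D₀ j))
      where
      g∣X : ∀ j → + g ∣ X j
      g∣X j = span cX (+ g) j (λ k → D-∣-opposite j k (g∣D₀ j) (g∣D₀ k))
      g≢0 : ℕ.NonZero g
      g≢0 = ℕ.≢-nonZero λ { refl → ℤ.<-irrefl (sym (0∣⇒≡0 (g∣D₀ o₁))) (D-pos {o₀} {o₁} (s≤s z≤n)) }
      instance
        _ = g≢0
      build : (ξ η : Vertex → ℤ) → (∀ j → X j ≡ ξ j * + g) → (∀ j → D o₀ j ≡ η j * + g) → Reduced
      build ξ η X≡ D₀≡ = record { g = g ; g≢0 = g≢0 ; u = u ; u₀ = cong₂ _,_ ξ₀ η₀ ; D≡ = D≡ ; coprime = coprime }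
        where
        u : Vertex → V
        u j = ξ j , η j
        ξ₀ : ξ o₀ ≡ 1ℤ
        ξ₀ = ℤ.*-cancelʳ-≡ (ξ o₀) 1ℤ (+ g) (trans (sym (X≡ o₀)) (trans X₀ (sym (ℤ.*-identityˡ (+ g)))))
        η₀ : η o₀ ≡ 0ℤ
        η₀ = ℤ.*-cancelʳ-≡ (η o₀) 0ℤ (+ g) (trans (sym (D₀≡ o₀)) (D-self o₀))
        D≡ : ∀ i j → D i j ≡ det (u i) (u j) * + g
        D≡ i j = sym (ℤ.*-cancelˡ-≡ (+ g) (det (u i) (u j) * + g) (D i j) (begin
          + g * (det (u i) (u j) * + g)                     ≡⟨ lemma (ξ i) (ξ j) (η i) (η j) (+ g) ⟩
          ξ i * + g * (η j * + g) - ξ j * + g * (η i * + g)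
            ≡⟨ cong₂ _-_ (cong₂ _*_ (X≡ i) (D₀≡ j)) (cong₂ _*_ (X≡ j) (D₀≡ i)) ⟨
          X i * D o₀ j - X j * D o₀ i                       ≡⟨ plücker cX i j ⟩
          X o₀ * D i j                                      ≡⟨ cong (_* D i j) X₀ ⟩
          + g * D i j                                       ∎))
          where
          open ≡-Reasoning
          lemma : ∀ x x′ y y′ g → g * ((x * y′ - y * x′) * g) ≡ x * g * (y′ * g) - x′ * g * (y * g)
          lemma = solve-∀
        -- If `q` divides both coordinates at `i`, then q g divides `D o₀ i` and every `D i j`. The
        -- triangle condition carries this to every `D o₀ j`, and `span` to `X o₀`, which is g;
        -- cancelling g leaves `q` dividing 1.
        coprime : ∀ i q → q ∣ ξ i → q ∣ η i → q ∣ 1ℤ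
        coprime i q q∣ξ q∣η = *-cancelʳ-∣ (+ g) {q} {1ℤ} (subst (q * + g ∣_) (trans X₀ (sym (ℤ.*-identityˡ (+ g))))
          (span cX (q * + g) o₀ λ j → D-∣-trans i j
            (subst (q * + g ∣_) (sym (D₀≡ i)) (*-monoˡ-∣ (+ g) {q} {η i} q∣η))
            (subst (q * + g ∣_) (sym (D≡ i j)) (*-monoˡ-∣ (+ g) {q} {det (u i) (u j)}
              (∣m∣n⇒∣m-n (∣m⇒∣m*n (η j) q∣ξ) (∣m⇒∣m*n (ξ j) q∣η))))))

-- Choosing the shear coefficient s

module _ {n} (c : Labels (suc (suc (suc n)))) (fr : IsPosFrieze (suc (suc (suc n))) c)
         (triangle : TriangleCondition c) (cond : PrimeCondition c) (red : Reduction.Reduced c fr triangle) where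
  open Signed c fr
  open Reduction.Reduced red

  private
    instance _ = g≢0
    Vertex = Fin (suc (suc (suc n)))
    ξ η : Vertex → ℤ
    ξ i = proj₁ (u i)
    η i = proj₂ (u i)

    -- Since no vector `u i` vanishes modulo a prime, this says that -s is not among the slopes ξ/η
    -- in 𝔽ₚ.
    Avoids : ℕ → ℤ → Set
    Avoids p s = ∀ i → ¬ (+ p ∣ ξ i + s * η i)

    Avoids-periodic : ∀ {p s t} → + p ∣ t - s → Avoids p s → Avoids p t
    Avoids-periodic {p} {s} {t} p∣t-s avoid i p∣ = avoid i (subst (+ p ∣_) (lemma (ξ i) (η i) s t)
      (∣m∣n⇒∣m-n p∣ (∣m⇒∣m*n (η i) p∣t-s)))
      where
      lemma : ∀ x y s t → x + t * y - (t - s) * y ≡ x + s * y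
      lemma = solve-∀

    -- If every residue r is hit by some vertex k r, these vertices together with o₀ are p + 1
    -- distinct points of the projective line over 𝔽ₚ.
    module _ {p} (pr : Prime p) (p∣g : p ℕ.∣ g) (k : Fin p → Vertex)
             (hit : ∀ r → + p ∣ ξ (k r) + + toℕ r * η (k r)) where
      p∤η : ∀ r → ¬ (+ p ∣ η (k r))
      p∤η r p∣η = prime∤1 pr (coprime (k r) (+ p) (∣m+n∣n⇒∣m (hit r) (∣n⇒∣m*n (+ toℕ r) p∣η)) p∣η)

      f : Fin (suc p) → Vertex
      f F.zero    = o₀
      f (F.suc r) = k r

      p∤toℕ-diff : ∀ (r s : Fin p) → r F.< s → ¬ (+ p ∣ + toℕ s - + toℕ r)
      p∤toℕ-diff r s r<s p∣ = ℕ.<⇒≱ (ℕ.≤-<-trans (ℕ.m∸n≤m (toℕ s) (toℕ r)) (F.toℕ<n s))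
        (ℕ.∣⇒≤ {{ℕ.>-nonZero (ℕ.m<n⇒0<n∸m r<s)}}
          (subst (p ℕ.∣_) (cong ∣_∣ (trans (ℤ.[+m]-[+n]≡m⊖n (toℕ s) (toℕ r)) (ℤ.⊖-≥ (ℕ.<⇒≤ r<s)))) (∣⇒∣ᵤ p∣)))

      -- Modulo `p` the first coordinates are -r and -s times the second ones, so the determinant is
      -- (s - r) times the product of the two `η`.
      p∤det-kk : ∀ r s → r F.< s → ¬ (+ p ∣ det (u (k r)) (u (k s)))
      p∤det-kk r s r<s p∣ =
        Sum.[ p∤toℕ-diff r s r<s , (λ p∣ηη → Sum.[ p∤η r , p∤η s ] (euclid pr (η (k r)) (η (k s)) p∣ηη)) ]
        (euclid pr (+ toℕ s - + toℕ r) (η (k r) * η (k s))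
          (subst (+ p ∣_) (lemma (ξ (k r)) (η (k r)) (ξ (k s)) (η (k s)) (+ toℕ r) (+ toℕ s))
            (∣m∣n⇒∣m+n p∣ (∣m∣n⇒∣m-n (∣m⇒∣m*n (η (k r)) (hit s)) (∣m⇒∣m*n (η (k s)) (hit r))))))
        where
        lemma : ∀ x y x′ y′ r s → (x * y′ - y * x′) + ((x′ + s * y′) * y - (x + r * y) * y′) ≡ (s - r) * (y * y′)
        lemma = solve-∀

      p∤det-< : ∀ a b → a F.< b → ¬ (+ p ∣ det (u (f a)) (u (f b)))
      -- The vertex `o₀` is the point at infinity: its determinant with another vertex is the `η` of
      -- that vertex.
      p∤det-< F.zero (F.suc s) _ p∣ = p∤η s (subst (+ p ∣_)
        (trans (cong (λ v → det v (u (k s))) u₀) (det-axis (u (k s)))) p∣)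
      p∤det-< (F.suc r) (F.suc s) (s≤s r<s) = p∤det-kk r s r<s

      p∤det : ∀ a b → a ≢ b → ¬ (+ p ∣ det (u (f a)) (u (f b)))
      p∤det a b a≢b with F.<-cmp a b
      ... | tri< a<b _ _ = p∤det-< a b a<b
      ... | tri≈ _ a≡b _ = contradiction a≡b a≢b
      ... | tri> _ _ b<a = p∤det-< b a b<a ∘ det-∣-sym (u (f a)) (u (f b))

      f-injective : ∀ {a b} → f a ≡ f b → a ≡ b
      f-injective {a} {b} eq = decidable-stable (a F.≟ b) λ a≢b → p∤det a b a≢b
        (subst (+ p ∣_) (sym (trans (cong (λ i → det (u i) (u (f b))) eq) (det-self (u (f b))))) (divides 0ℤ refl))

      c≡ : ∀ a b → a ≢ b → ∣ det (u (f a)) (u (f b)) ∣ ℕ.* g ≡ c (f a) (f b)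
      c≡ a b a≢b = trans (sym (ℤ.abs-* (det (u (f a)) (u (f b))) (+ g))) (trans (cong ∣_∣ (sym (D≡ (f a) (f b))))
        (∣D∣ (f a) (f b) (a≢b ∘ f-injective)))

      -- Each label among these vertices is g times a number prime to `p`, so all share the
      -- valuation of g, which is positive as `p` divides g; `no-equidistant` forbids this.
      not-all-hit : ⊥
      not-all-hit = refute (valuation pr g)
        where
        refute : ¬ (∃₂ λ v h → g ≡ p ℕ.^ v ℕ.* h × ¬ (p ℕ.∣ h))
        refute (zero , h , g≡ , p∤h) = p∤h (subst (p ℕ.∣_) (trans g≡ (ℕ.*-identityˡ h)) p∣g)
        refute (suc e , h , g≡ , p∤h) = no-equidistant {c = c} cond pr e f f-injective λ a b a≢b →
          subst (λ x → HasValuation p x (suc e)) (c≡ a b a≢b)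
            (hasValuation-* pr ∣ det (u (f a)) (u (f b)) ∣ g (suc e) h g≡ p∤h (p∤det a b a≢b ∘ ∣ᵤ⇒∣))

    avoid : ∀ {p} → Prime p → p ℕ.∣ g → ∃ (Avoids p)
    avoid {p} pr p∣g with F.any? (λ (r : Fin p) → F.all? (λ i → ¬? (+ p ∣? ξ i + + toℕ r * η i)))
    ... | yes (r , good) = + toℕ r , good
    ... | no none = contradiction (λ r → proj₂ (hit r)) (not-all-hit pr p∣g (λ r → proj₁ (hit r)))
      where
      hit : ∀ r → ∃[ i ] + p ∣ ξ i + + toℕ r * η i
      hit r = map₂ (decidable-stable (+ p ∣? _))
        (F.¬∀⟶∃¬ _ _ (λ i → ¬? (+ p ∣? ξ i + + toℕ r * η i)) λ all → none (r , all))

    avoid-all : ∃[ s ] (∀ p → Prime p → p ℕ.∣ g → Avoids p s)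
    avoid-all = from (factorise g)
      where
      from : PrimeFactorisation g → ∃[ s ] (∀ p → Prime p → p ℕ.∣ g → Avoids p s)
      from record { factors = ps ; isFactorisation = g≡ ; factorsPrime = prs } =
        map₂ (λ good p pr p∣g → All.lookup good (factorisationHasAllPrimeFactors pr (subst (p ℕ.∣_) g≡ p∣g) prs))
          (crt Avoids (λ {p} {s} {t} → Avoids-periodic {p} {s} {t}) ps prs (All.tabulate λ {p} p∈ps →
            avoid (All.lookup prs p∈ps) (subst (p ℕ.∣_) (sym g≡) (∈⇒∣product p∈ps))))

  conditions⇒appears : AppearsInCC c
  conditions⇒appears = from avoid-all
    where
    from : ∃[ s ] (∀ p → Prime p → p ℕ.∣ g → Avoids p s) → AppearsInCC c
    from (s , avoids) = realised⇒appears c v (cong₂ _,_ v₀₁ v₀₂) pos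
      ((λ i j i≢j → trans (cong ∣_∣ (det≡D i j)) (∣D∣ i j i≢j)) , λ i → noCommonPrime⇒primitive _ _ (coprime′ i))
      where
      v : Vertex → V
      -- The shear by `s` preserves determinants, and scaling the second coordinate restores the
      -- factor g.
      v i = ξ i + s * η i , + g * η i
      v₀₁ : ξ o₀ + s * η o₀ ≡ 1ℤ
      v₀₁ = trans (cong₂ (λ x y → x + s * y) (cong proj₁ u₀) (cong proj₂ u₀)) (cong (_+_ 1ℤ) (ℤ.*-zeroʳ s))
      v₀₂ : + g * η o₀ ≡ 0ℤ
      v₀₂ = trans (cong (+ g *_) (cong proj₂ u₀)) (ℤ.*-zeroʳ (+ g))
      det≡D : ∀ i j → det (v i) (v j) ≡ D i j
      det≡D i j = trans (lemma (ξ i) (η i) (ξ j) (η j) s (+ g)) (sym (D≡ i j))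
        where
        lemma : ∀ x y x′ y′ s g → (x + s * y) * (g * y′) - g * y * (x′ + s * y′) ≡ (x * y′ - y * x′) * g
        lemma = solve-∀
      pos : ∀ i j → i F.< j → 0ℤ ℤ.< det (v i) (v j)
      pos i j i<j = subst (0ℤ ℤ.<_) (sym (det≡D i j)) (D-pos i<j)
      coprime′ : ∀ i p → Prime p → + p ∣ ξ i + s * η i → ¬ (+ p ∣ + g * η i)
      coprime′ i p pr p∣x p∣y = Sum.[ (λ p∣g → avoids p pr (∣⇒∣ᵤ p∣g) i p∣x)
                                    , (λ p∣η → prime∤1 pr (coprime i (+ p) (∣m+n∣n⇒∣m p∣x (∣n⇒∣m*n s p∣η)) p∣η)) ]
                                  (euclid pr (+ g) (η i) p∣y)

theorem3p2 : ∀ (n : ℕ) → 3 ≤ n → (c : Labels n) → IsPosFrieze n c →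
    AppearsInCC c ⇔ (TriangleCondition c × PrimeCondition c)
theorem3p2 (suc (suc (suc n))) _ c fr = mk⇔
  (λ app → let v , realises = appears⇒realised c app
           in realisable⇒triangle {v = v} realises , realisable⇒prime {v = v} realises)
  (λ { (triangle , cond) → conditions⇒appears c fr triangle cond (Reduction.reduced c fr triangle) })
theorem3p2 (suc (suc zero)) (s≤s (s≤s ())) c fr
theorem3p2 (suc zero) (s≤s ()) c fr
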